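{- Let $q$ be a prime power and $0<k<n$, $0\le t\le k$ integers. If $q>\binom{n}{t}$ and $t<k$, then the graph $\Lambda_t(n,k)$ is connected. If $t=k$, the graph $\Lambda_k(n,k)$ is totally disconnected (it has no edges).
   Context: Let $V=\mathbb{F}_q^n$ with its standard basis. An $[n,m]$-linear code is an $m$-dimensional subspace of $V$; a generator matrix is an $m\times n$ matrix whose rows form a basis of it. $\mathcal{C}_t(n,m)$ denotes the set of $[n,m]$-codes such that any $t$ columns of a generator matrix are linearly independent. $\Lambda_t(n,k)$ is the graph with vertex set $\mathcal{C}_t(n,k)$ in which $X,Y$ are adjacent iff $X\cap Y\in\mathcal{C}_t(n,k-1)$. The empty graph is considered connected. -}

module Defs where

open import Level using (Level; _⊔_) renaming (suc to lsuc)
open import Data.Nat using (ℕ; zero; suc; _^_; _∸_)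
open import Data.Nat.Primality using (Prime)
open import Data.Fin using (Fin; zero; suc)
open import Data.Product using (Σ; ∃; _×_; _,_)
open import Data.Sum using (_⊎_)
open import Relation.Nullary using (¬_)
open import Relation.Binary.PropositionalEquality using (_≡_)
open import Function.Definitions using (Injective)
open import Algebra.Bundles using (CommutativeRing)

IsPrimePower : ℕ → Set
IsPrimePower q = Σ ℕ λ p → Σ ℕ λ e → Prime p × q ≡ p ^ suc e

record Field (c ℓ : Level) : Set (lsuc (c ⊔ ℓ)) where
  field
    commutativeRing : CommutativeRing c ℓ
  open CommutativeRing commutativeRing public
  field
    1≉0     : ¬ (1# ≈ 0#)
    inverse : ∀ x → ¬ (x ≈ 0#) → Σ Carrier λ y → (x * y) ≈ 1#

HasCardinality : ∀ {c ℓ} → Field c ℓ → ℕ → Set (c ⊔ ℓ)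
HasCardinality F q =
  Σ (Fin q → Carrier) λ e →
    (∀ i j → e i ≈ e j → i ≡ j) × (∀ x → Σ (Fin q) λ i → e i ≈ x)
  where open Field F

module LinearAlgebra {c ℓ} (F : Field c ℓ) where
  open Field F using (Carrier; _≈_; _+_; _*_; 0#; 1#)

  Vec : ℕ → Set c
  Vec n = Fin n → Carrier

  Σ[_] : ∀ {m} → (Fin m → Carrier) → Carrier
  Σ[_] {zero}  f = 0#
  Σ[_] {suc m} f = f zero + Σ[_] (λ i → f (suc i))

  _≋_ : ∀ {n} → Vec n → Vec n → Set ℓ
  u ≋ v = ∀ j → u j ≈ v j

  lincomb : ∀ {m n} → (Fin m → Carrier) → (Fin m → Vec n) → Vec n
  lincomb a v j = Σ[ (λ i → a i * v i j) ]

  LinIndep : ∀ {m n} → (Fin m → Vec n) → Set (c ⊔ ℓ)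
  LinIndep {m} v = ∀ (a : Fin m → Carrier) → lincomb a v ≋ (λ _ → 0#) → ∀ i → a i ≈ 0#

  Subset : ℕ → Set (lsuc (c ⊔ ℓ))
  Subset n = Vec n → Set (c ⊔ ℓ)

  IsGeneratorMatrix : ∀ {m n} → Subset n → (Fin m → Vec n) → Set (c ⊔ ℓ)
  IsGeneratorMatrix {m} X G =
    LinIndep G ×
    (∀ v → (X v → Σ (Fin m → Carrier) λ a → v ≋ lincomb a G)
         × (Σ (Fin m → Carrier) (λ a → v ≋ lincomb a G) → X v))

  IsCode : (n m : ℕ) → Subset n → Set (c ⊔ ℓ)
  IsCode n m X = Σ (Fin m → Vec n) (IsGeneratorMatrix X)

  InC : (t n m : ℕ) → Subset n → Set (c ⊔ ℓ)
  InC t n m X =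
    Σ (Fin m → Vec n) λ G → IsGeneratorMatrix X G ×
      (∀ (s : Fin t → Fin n) → Injective _≡_ _≡_ s →
         LinIndep (λ (j : Fin t) (i : Fin m) → G i (s j)))

  Vertex : (t n k : ℕ) → Set (lsuc (c ⊔ ℓ))
  Vertex t n k = Σ (Subset n) (InC t n k)

  _∩_ : ∀ {n} → Subset n → Subset n → Subset n
  (X ∩ Y) v = X v × Y v

  Adjacent : (t n k : ℕ) → Vertex t n k → Vertex t n k → Set (c ⊔ ℓ)
  Adjacent t n k (X , _) (Y , _) = InC t n (k ∸ 1) (X ∩ Y)

  SameVertex : ∀ {t n k} → Vertex t n k → Vertex t n k → Set (c ⊔ ℓ)
  SameVertex (X , _) (Y , _) = ∀ v → (X v → Y v) × (Y v → X v)

  data Walk (t n k : ℕ) : Vertex t n k → Vertex t n k → Set (lsuc (c ⊔ ℓ)) where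
    here : ∀ {X Y} → SameVertex X Y → Walk t n k X Y
    step : ∀ {X Z Y} → Adjacent t n k X Z → Walk t n k Z Y → Walk t n k X Y

  -- connected (the empty graph is connected, vacuously)
  Connected : (t n k : ℕ) → Set (lsuc (c ⊔ ℓ))
  Connected t n k = ∀ (X Y : Vertex t n k) → Walk t n k X Y

  NoEdges : (t n k : ℕ) → Set (lsuc (c ⊔ ℓ))
  NoEdges t n k = ∀ (X Y : Vertex t n k) → ¬ Adjacent t n k X Y

{-# OPTIONS --safe #-}
-- Call a family of vectors good if any t of its columns are independent; any family whose span
-- contains a good family is good.  Hence if A ⊆ X is good with fewer than k vectors, X has a
-- hyperplane H ⊇ A, and for v ∉ X the code H + ⟨v⟩ is a neighbour of X containing A and v.
--
-- A family of t vectors is good as soon as its rows stay independent on every set S of t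
-- coordinates.  If B is such a family with fewer than t vectors, for every S there is a nonzero
-- functional b_S on F^S vanishing on B, and it does not vanish on a good code Y.  As q > C(n,t),
-- Y is not covered by the C(n,t) kernels, so some m ∈ Y extends B.  Thus X contains a good family
-- of t vectors, and its vectors can be replaced one by one by vectors of Y, while X is moved
-- along edges so as to contain the current family.  Finally the remaining vectors of a basis of Y
-- are inserted into X.
module Submission where

open import Defs
open import Level using (Level; _⊔_)
open import Data.Nat using (ℕ; zero; suc; _<_; _≤_; _>_; _^_; z≤n; s≤s; s≤s⁻¹) renaming (_+_ to _+ℕ_; _∸_ to _∸ℕ_)
open import Data.Nat.Properties using (^-monoʳ-<; ≤-refl; ≤-reflexive; ≤-trans; <⇒≤; n<1+n; +-suc; m∸n+n≡m; m≤n+m) renaming (+-identityʳ to +ℕ-identityʳ)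
open import Data.Nat.Combinatorics using (_C_; nCk+nC[k+1]≡[n+1]C[k+1])
open import Data.Fin using (Fin; zero; suc; toℕ; inject₁; inject≤; punchIn; punchOut; finToFun; funToFin) renaming (_≟_ to _≟ꟳ_)
open import Data.Fin.Properties using (pigeonhole; funToFin-finToFin; finToFun-funToFin; ¬∀⟶∃¬; any?; all?; toℕ-inject₁; toℕ<n; inject≤-injective; suc-injective; punchIn-injective; punchInᵢ≢i; punchIn-punchOut; <⇒≢)
open import Data.List using (List; []; _∷_; _++_; map; length)
open import Data.List.Properties using (length-++; length-map)
open import Data.List.Membership.Propositional using (_∈_)
open import Data.List.Membership.Propositional.Properties using (∈-map⁺; ∈-++⁺ˡ; ∈-++⁺ʳ)
open import Data.List.Relation.Unary.All as All using (All; []; _∷_)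
open import Data.List.Relation.Unary.All.Properties using (++⁺; map⁺; map⁻; ¬Any⇒All¬)
open import Data.List.Relation.Unary.Any as Any using (Any; here)
open import Data.List.Relation.Unary.Any.Properties using (lookup-index)
open import Data.Product using (∃; _×_; _,_; proj₁; proj₂)
open import Data.Vec.Functional using () renaming (_∷_ to _◂_)
open import Function using (_∘_; id)
open import Function.Definitions using (Injective)
open import Relation.Binary.PropositionalEquality using (_≡_; _≢_) renaming (refl to ≡-refl; sym to ≡-sym; trans to ≡-trans; cong to ≡-cong; cong₂ to ≡-cong₂; subst to ≡-subst)
open import Relation.Nullary using (¬_; Dec; yes; no; contradiction)
open import Relation.Nullary.Decidable using (map′; decidable-stable)
import Algebra.Properties.Ring
import Algebra.Solver.Ring.NaturalCoefficients.Default
import Relation.Binary.Reasoning.Setoid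

-- Finite index sets and the enumeration of `t`-element subsets.

distinct⇒1<n : ∀ {n} (i j : Fin n) → i ≢ j → 1 < n
distinct⇒1<n {suc zero}    zero zero i≢j = contradiction ≡-refl i≢j
distinct⇒1<n {suc (suc n)} _    _    _   = s≤s (s≤s z≤n)

-- Increasing maps, one for each t-element subset.
subsets : ∀ n t → List (Fin t → Fin n)
subsets n       zero    = (λ ()) ∷ []
subsets zero    (suc t) = []
subsets (suc n) (suc t) = map (λ s → zero ◂ (suc ∘ s)) (subsets n t) ++ map (suc ∘_) (subsets n (suc t))

length-subsets : ∀ n t → length (subsets n t) ≡ n C t
length-subsets n       zero    = ≡-refl
length-subsets zero    (suc t) = ≡-refl
length-subsets (suc n) (suc t) =
  ≡-trans (length-++ (map (λ s → zero ◂ (suc ∘ s)) (subsets n t)))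
    (≡-trans (≡-cong₂ _+ℕ_ (≡-trans (length-map _ (subsets n t)) (length-subsets n t))
                           (≡-trans (length-map _ (subsets n (suc t))) (length-subsets n (suc t))))
             (nCk+nC[k+1]≡[n+1]C[k+1] n t))

subsets-injective : ∀ n t → All (Injective _≡_ _≡_) (subsets n t)
subsets-injective n       zero    = (λ { {()} }) ∷ []
subsets-injective zero    (suc t) = []
subsets-injective (suc n) (suc t) =
  ++⁺ (map⁺ (All.map with-zero (subsets-injective n t)))
      (map⁺ (All.map without-zero (subsets-injective n (suc t))))
  where
  with-zero : ∀ {t} {s : Fin t → Fin n} → Injective _≡_ _≡_ s → Injective _≡_ _≡_ (zero ◂ (suc ∘ s))
  with-zero inj {zero}  {zero}  eq = ≡-refl
  with-zero inj {suc i} {suc j} eq = ≡-cong suc (inj (suc-injective eq))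
  without-zero : ∀ {t} {s : Fin t → Fin n} → Injective _≡_ _≡_ s → Injective _≡_ _≡_ (Fin.suc ∘ s)
  without-zero inj eq = inj (suc-injective eq)

_⊑_ : ∀ {t u n} → (Fin t → Fin n) → (Fin u → Fin n) → Set
s ⊑ r = ∀ i → ∃ λ j → s i ≡ r j

lower : ∀ {t n} (s : Fin t → Fin (suc n)) → (∀ i → zero ≢ s i) → Fin t → Fin n
lower s s≢0 i = punchOut (s≢0 i)

suc-lower : ∀ {t n} (s : Fin t → Fin (suc n)) (s≢0 : ∀ i → zero ≢ s i) i → suc (lower s s≢0 i) ≡ s i
suc-lower s s≢0 i = punchIn-punchOut (s≢0 i)

lower-injective : ∀ {t n} (s : Fin t → Fin (suc n)) (s≢0 : ∀ i → zero ≢ s i) →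
  Injective _≡_ _≡_ s → Injective _≡_ _≡_ (lower s s≢0)
lower-injective s s≢0 inj {i} {j} eq =
  inj (≡-trans (≡-sym (suc-lower s s≢0 i)) (≡-trans (≡-cong suc eq) (suc-lower s s≢0 j)))

-- Whether `zero` is a value of `s` decides in which half of the list to recurse. Containment of
-- images ignores order, and it lets a relation on the coordinates `s` be read on the coordinates
-- `r`.
subsets-cover : ∀ n t (s : Fin t → Fin n) → Injective _≡_ _≡_ s → ∃ λ r → r ∈ subsets n t × r ⊑ s
subsets-cover n       zero    s inj = (λ ()) , here ≡-refl , λ ()
subsets-cover zero    (suc t) s inj with () ← s zero
subsets-cover (suc n) (suc t) s inj with any? (λ i → zero ≟ꟳ s i)
... | no ∄ = suc ∘ proj₁ rec , ∈-++⁺ʳ _ (∈-map⁺ (suc ∘_) (proj₁ (proj₂ rec))) , cover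
  where
  s≢0 : ∀ i → zero ≢ s i
  s≢0 i eq = ∄ (i , eq)
  rec = subsets-cover n (suc t) (lower s s≢0) (lower-injective s s≢0 inj)
  cover : (suc ∘ proj₁ rec) ⊑ s
  cover i with j , eq ← proj₂ (proj₂ rec) i = j , ≡-trans (≡-cong suc eq) (suc-lower s s≢0 j)
... | yes (p , 0≡sp) = zero ◂ (suc ∘ proj₁ rec) , ∈-++⁺ˡ (∈-map⁺ _ (proj₁ (proj₂ rec))) , cover
  where
  -- By injectivity `zero` is attained only at `p`, so off `p` the values can be lowered.
  s≢0 : ∀ i → zero ≢ s (punchIn p i)
  s≢0 i eq = punchInᵢ≢i p i (inj (≡-trans (≡-sym eq) 0≡sp))
  rec = subsets-cover n t (lower (s ∘ punchIn p) s≢0)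
          (lower-injective (s ∘ punchIn p) s≢0 (λ {i} {j} → punchIn-injective p i j ∘ inj))
  cover : (zero ◂ (suc ∘ proj₁ rec)) ⊑ s
  cover zero    = p , 0≡sp
  cover (suc i) with j , eq ← proj₂ (proj₂ rec) i =
    punchIn p j , ≡-trans (≡-cong suc eq) (suc-lower (s ∘ punchIn p) s≢0 j)

-- Field identities for solving linear equations.

module FieldProperties {c ℓ : Level} (F : Field c ℓ) where
  open Field F hiding (zero)
  open Algebra.Properties.Ring ring using (-‿distribˡ-*; +-inverseˡ-unique; -1*x≈-x; -‿involutive)
  open Relation.Binary.Reasoning.Setoid setoid

  0*x+y≈y : ∀ {x u v} → x ≈ 0# → x * u + v ≈ v
  0*x+y≈y {x} {u} {v} x≈0 = trans (+-congʳ (trans (*-congʳ x≈0) (zeroˡ u))) (+-identityˡ v)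

  x*y≈0⇒x≈0 : ∀ {x y} → x * y ≈ 0# → ¬ (y ≈ 0#) → x ≈ 0#
  x*y≈0⇒x≈0 {x} {y} xy≈0 y≉0 with z , yz≈1 ← inverse y y≉0 = begin
    x           ≈⟨ *-identityʳ x ⟨
    x * 1#      ≈⟨ *-congˡ yz≈1 ⟨
    x * (y * z) ≈⟨ *-assoc x y z ⟨
    x * y * z   ≈⟨ *-congʳ xy≈0 ⟩
    0# * z      ≈⟨ zeroˡ z ⟩
    0#          ∎

  solve-coefficient : ∀ {x u v y} → x * u + v ≈ 0# → u * y ≈ 1# → x ≈ - v * y
  solve-coefficient {x} {u} {v} {y} eq uy≈1 = begin
    x           ≈⟨ *-identityʳ x ⟨
    x * 1#      ≈⟨ *-congˡ uy≈1 ⟨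
    x * (u * y) ≈⟨ *-assoc x u y ⟨
    x * u * y   ≈⟨ *-congʳ (+-inverseˡ-unique (x * u) v eq) ⟩
    - v * y     ∎

  -- The right-hand side is shaped as two nested `axpy`s ending in the zero vector, so that
  -- `axpy-closed` applies to it directly.
  solve-vector : ∀ {x y u v w} → w ≈ x * u + v → x * y ≈ 1# → u ≈ y * w + (- y * v + 0#)
  solve-vector {x} {y} {u} {v} {w} eq xy≈1 = sym (begin
    y * w + (- y * v + 0#)       ≈⟨ +-congˡ (+-identityʳ _) ⟩
    y * w + - y * v              ≈⟨ +-congʳ (*-congˡ eq) ⟩
    y * (x * u + v) + - y * v    ≈⟨ +-congʳ (distribˡ y _ v) ⟩
    y * (x * u) + y * v + - y * v ≈⟨ +-assoc _ _ _ ⟩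
    y * (x * u) + (y * v + - y * v) ≈⟨ +-cong (sym (*-assoc y x u)) (+-congˡ (sym (-‿distribˡ-* y v))) ⟩
    y * x * u + (y * v + - (y * v)) ≈⟨ +-cong (*-congʳ (trans (*-comm y x) xy≈1)) (-‿inverseʳ _) ⟩
    1# * u + 0#                  ≈⟨ trans (+-identityʳ _) (*-identityˡ u) ⟩
    u                            ∎)

  -1*x+y≈0⇒y≈x : ∀ {x y} → - 1# * x + y ≈ 0# → y ≈ x
  -1*x+y≈0⇒y≈x {x} {y} eq = begin
    y         ≈⟨ -‿involutive y ⟨
    - (- y)   ≈⟨ -‿cong (+-inverseˡ-unique _ y eq) ⟨
    - (- 1# * x) ≈⟨ -‿cong (-1*x≈-x x) ⟩
    - (- x)   ≈⟨ -‿involutive x ⟩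
    x         ∎

  y≈x⇒-1*x+y≈0 : ∀ {x y} → y ≈ x → - 1# * x + y ≈ 0#
  y≈x⇒-1*x+y≈0 {x} {y} eq = trans (+-cong (-1*x≈-x x) eq) (-‿inverseˡ x)

-- Linear combinations, subspaces and coordinate functionals.

module Linear {c ℓ : Level} (F : Field c ℓ) where
  open Field F hiding (zero)
  open LinearAlgebra F
  open FieldProperties F
  open Algebra.Solver.Ring.NaturalCoefficients.Default commutativeSemiring using (solve; _:+_; _:*_; _:=_)
  open Relation.Binary.Reasoning.Setoid setoid

  axpy : ∀ {n} → Carrier → Vec n → Vec n → Vec n
  axpy x u v j = x * u j + v j

  Σ-cong : ∀ {m} {f g : Vec m} → f ≋ g → Σ[ f ] ≈ Σ[ g ]
  Σ-cong {zero}  f≋g = refl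
  Σ-cong {suc m} f≋g = +-cong (f≋g zero) (Σ-cong (f≋g ∘ suc))

  Σ-zero : ∀ {m} {f : Vec m} → f ≋ (λ _ → 0#) → Σ[ f ] ≈ 0#
  Σ-zero {zero}  f≋0 = refl
  Σ-zero {suc m} f≋0 = trans (+-cong (f≋0 zero) (Σ-zero (f≋0 ∘ suc))) (+-identityˡ 0#)

  Σ-axpy : ∀ {m} x (f g : Vec m) → Σ[ axpy x f g ] ≈ x * Σ[ f ] + Σ[ g ]
  Σ-axpy {zero}  x f g = sym (trans (+-identityʳ _) (zeroʳ x))
  Σ-axpy {suc m} x f g = begin
    x * f zero + g zero + Σ[ axpy x (f ∘ suc) (g ∘ suc) ]
      ≈⟨ +-congˡ (Σ-axpy x (f ∘ suc) (g ∘ suc)) ⟩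
    x * f zero + g zero + (x * Σ[ f ∘ suc ] + Σ[ g ∘ suc ])
      ≈⟨ solve 5 (λ x a b s t → x :* a :+ b :+ (x :* s :+ t) := x :* (a :+ s) :+ (b :+ t)) refl
           x (f zero) (g zero) Σ[ f ∘ suc ] Σ[ g ∘ suc ] ⟩
    x * (f zero + Σ[ f ∘ suc ]) + (g zero + Σ[ g ∘ suc ]) ∎

  unit : ∀ {m} → Fin m → Vec m
  unit zero    = 1# ◂ (λ _ → 0#)
  unit (suc p) = 0# ◂ unit p

  Σ-unit : ∀ {m} (p : Fin m) (f : Vec m) → Σ[ (λ i → unit p i * f i) ] ≈ f p
  Σ-unit zero    f = trans (+-cong (*-identityˡ _) (Σ-zero (λ i → zeroˡ (f (suc i))))) (+-identityʳ _)
  Σ-unit (suc p) f = trans (0*x+y≈y refl) (Σ-unit p (f ∘ suc))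

  lincomb-cong : ∀ {m n} {a b : Vec m} (A : Fin m → Vec n) → a ≋ b → lincomb a A ≋ lincomb b A
  lincomb-cong A a≋b j = Σ-cong (λ i → *-congʳ (a≋b i))

  lincomb-axpy : ∀ {m n} x (a b : Vec m) (A : Fin m → Vec n) →
    lincomb (axpy x a b) A ≋ axpy x (lincomb a A) (lincomb b A)
  lincomb-axpy x a b A j = trans
    (Σ-cong (λ i → solve 4 (λ x a b v → (x :* a :+ b) :* v := x :* (a :* v) :+ b :* v) refl x (a i) (b i) (A i j)))
    (Σ-axpy x (λ i → a i * A i j) (λ i → b i * A i j))

  record IsSubspace {n p} (P : Vec n → Set p) : Set (c ⊔ ℓ ⊔ p) where
    field
      resp        : ∀ {u v} → u ≋ v → P u → P v
      zero-closed : P (λ _ → 0#)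
      axpy-closed : ∀ x {u v} → P u → P v → P (axpy x u v)

    lincomb-closed : ∀ {m} {A : Fin m → Vec n} → (∀ i → P (A i)) → ∀ a → P (lincomb a A)
    lincomb-closed {zero}  PA a = zero-closed
    lincomb-closed {suc m} PA a = axpy-closed (a zero) (PA zero) (lincomb-closed (PA ∘ suc) (a ∘ suc))

  open IsSubspace

  Span : ∀ {m n} → (Fin m → Vec n) → Subset n
  Span {m} A v = ∃ λ (a : Fin m → Carrier) → v ≋ lincomb a A

  span-isSubspace : ∀ {m n} (A : Fin m → Vec n) → IsSubspace (Span A)
  span-isSubspace A .resp u≋v (a , eq) = a , λ j → trans (sym (u≋v j)) (eq j)
  span-isSubspace A .zero-closed = (λ _ → 0#) , λ j → sym (Σ-zero (λ i → zeroˡ (A i j)))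
  span-isSubspace A .axpy-closed x (a , eqa) (b , eqb) =
    axpy x a b , λ j → trans (+-cong (*-congˡ (eqa j)) (eqb j)) (sym (lincomb-axpy x a b A j))

  span-row : ∀ {m n} (A : Fin m → Vec n) i → Span A (A i)
  span-row A i = unit i , λ j → sym (Σ-unit i (λ l → A l j))

  span-tail : ∀ {m n} (A : Fin (suc m) → Vec n) {v} → Span (A ∘ suc) v → Span A v
  span-tail A (a , eq) = 0# ◂ a , λ j → trans (eq j) (sym (0*x+y≈y refl))

  span-least : ∀ {m n p} {P : Vec n → Set p} → IsSubspace P → {A : Fin m → Vec n} → (∀ i → P (A i)) →
    ∀ {v} → Span A v → P v
  span-least subP PA (a , eq) = resp subP (λ j → sym (eq j)) (lincomb-closed subP PA a)

  -- On the rows of a matrix this form computes, definitionally, the combination with coefficients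
  -- `b` of the columns chosen by `s`. So a column relation is a functional that kills every row.
  functional : ∀ {t n} → (Fin t → Fin n) → Vec t → Vec n → Carrier
  functional s b v = Σ[ (λ l → b l * v (s l)) ]

  functional-axpy : ∀ {t n} (s : Fin t → Fin n) b x u v →
    functional s b (axpy x u v) ≈ x * functional s b u + functional s b v
  functional-axpy s b x u v = trans
    (Σ-cong (λ l → solve 4 (λ b x u v → b :* (x :* u :+ v) := x :* (b :* u) :+ b :* v) refl (b l) x (u (s l)) (v (s l))))
    (Σ-axpy x (λ l → b l * u (s l)) (λ l → b l * v (s l)))

  kernel-isSubspace : ∀ {t n} (s : Fin t → Fin n) b → IsSubspace (λ v → functional s b v ≈ 0#)
  kernel-isSubspace s b .resp u≋v fu≈0 = trans (Σ-cong (λ l → *-congˡ (sym (u≋v (s l))))) fu≈0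
  kernel-isSubspace s b .zero-closed = Σ-zero (λ l → zeroʳ (b l))
  kernel-isSubspace s b .axpy-closed x {u} {v} fu≈0 fv≈0 = begin
    functional s b (axpy x u v)                ≈⟨ functional-axpy s b x u v ⟩
    x * functional s b u + functional s b v    ≈⟨ +-cong (*-congˡ fu≈0) fv≈0 ⟩
    x * 0# + 0#                                ≈⟨ trans (+-identityʳ _) (zeroʳ x) ⟩
    0#                                         ∎

  relation : ∀ {m n} (A : Fin m → Vec n) (φ ψ : Vec m) → lincomb φ A ≋ lincomb ψ A →
    lincomb (axpy (- 1#) ψ φ) A ≋ (λ _ → 0#)
  relation A φ ψ eq j = trans (lincomb-axpy (- 1#) ψ φ A j) (y≈x⇒-1*x+y≈0 (eq j))

  linIndep-init : ∀ {m n} (A : Fin (suc m) → Vec n) → LinIndep A → LinIndep (A ∘ inject₁)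
  linIndep-init A indep a eq i =
    trans (sym (extend-inject₁ a i)) (indep (extend a) (λ j → trans (Σ-extend a (λ i → A i j)) (eq j)) (inject₁ i))
    where
    extend : ∀ {m} → Vec m → Vec (suc m)
    extend {zero}  a = λ _ → 0#
    extend {suc m} a = a zero ◂ extend (a ∘ suc)
    extend-inject₁ : ∀ {m} (a : Vec m) i → extend a (inject₁ i) ≈ a i
    extend-inject₁ a zero    = refl
    extend-inject₁ a (suc i) = extend-inject₁ (a ∘ suc) i
    Σ-extend : ∀ {m} (a : Vec m) (f : Vec (suc m)) → Σ[ (λ i → extend a i * f i) ] ≈ Σ[ (λ i → a i * f (inject₁ i)) ]
    Σ-extend {zero}  a f = 0*x+y≈y refl
    Σ-extend {suc m} a f = +-congˡ (Σ-extend (a ∘ suc) (f ∘ suc))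

  -- Column independence and row independence on sets of `t` coordinates.

  Good : ∀ t {m n} → (Fin m → Vec n) → Set (c ⊔ ℓ)
  Good t {m} {n} G = ∀ (s : Fin t → Fin n) → Injective _≡_ _≡_ s → LinIndep (λ j i → G i (s j))

  RowGood : ∀ t {m n} → (Fin m → Vec n) → Set (c ⊔ ℓ)
  RowGood t {m} {n} A = ∀ (s : Fin t → Fin n) → Injective _≡_ _≡_ s → LinIndep (λ i l → A i (s l))

  -- A column relation of `G` is a functional killing the rows of `G`, hence also their span and the
  -- rows of `A`.
  good-mono : ∀ {t m k n} (A : Fin m → Vec n) (G : Fin k → Vec n) → (∀ i → Span G (A i)) → Good t A → Good t G
  good-mono A G A⊆G goodA s inj b eq =
    goodA s inj b (λ i → span-least (kernel-isSubspace s b) eq (A⊆G i))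

  rowGood⇒linIndep : ∀ {t m n} (A : Fin m → Vec n) → t ≤ n → RowGood t A → LinIndep A
  rowGood⇒linIndep A t≤n rowGood a eq =
    rowGood (λ i → inject≤ i t≤n) (λ {i} {j} → inject≤-injective t≤n t≤n i j) a (λ l → eq _)

  -- Listed sets suffice, as the values of some listed `r` lie among those of `s`. Applying the
  -- functional of `r` to a relation kills `B` and isolates the coefficient of `m`; a relation of
  -- `B` on `s` remains.
  rowGood-∷ : ∀ {t j n} (B : Fin j → Vec n) m → RowGood t B →
    All (λ s → ∃ λ b → (∀ i → functional s b (B i) ≈ 0#) × ¬ (functional s b m ≈ 0#)) (subsets n t) →
    RowGood t (m ◂ B)
  rowGood-∷ {t} {n = n} B m rowGood separated s inj a eq with subsets-cover n t s inj
  ... | r , r∈ , r⊑s with All.lookup separated r∈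
  ... | b , fB≈0 , fm≉0 = λ where
        zero    → a₀≈0
        (suc i) → rowGood s inj (a ∘ suc) (λ l → trans (sym (0*x+y≈y a₀≈0)) (eq l)) i
    where
    eq-r : ∀ l → lincomb a (m ◂ B) (r l) ≈ 0#
    eq-r l = trans (reflexive (≡-cong (lincomb a (m ◂ B)) (proj₂ (r⊑s l)))) (eq (proj₁ (r⊑s l)))
    a₀≈0 : a zero ≈ 0#
    a₀≈0 = x*y≈0⇒x≈0 (begin
      a zero * functional r b m
        ≈⟨ +-identityʳ _ ⟨
      a zero * functional r b m + 0#
        ≈⟨ +-congˡ (lincomb-closed (kernel-isSubspace r b) {A = B} fB≈0 (a ∘ suc)) ⟨
      a zero * functional r b m + functional r b (lincomb (a ∘ suc) B)
        ≈⟨ functional-axpy r b (a zero) m (lincomb (a ∘ suc) B) ⟨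
      functional r b (lincomb a (m ◂ B))
        ≈⟨ Σ-zero (λ l → trans (*-congˡ (eq-r l)) (zeroʳ (b l))) ⟩
      0# ∎) fm≉0

-- Counting vectors over a finite field.

module Finite {c ℓ : Level} (q : ℕ) (F : Field c ℓ) (card : HasCardinality F q) where
  open Field F hiding (zero)
  open LinearAlgebra F
  open FieldProperties F
  open Linear F
  open IsSubspace
  open Relation.Binary.Reasoning.Setoid setoid

  element : Fin q → Carrier
  element = proj₁ card

  index : Carrier → Fin q
  index x = proj₁ (proj₂ (proj₂ card) x)

  element-index : ∀ x → element (index x) ≈ x
  element-index x = proj₂ (proj₂ (proj₂ card) x)

  element-injective : ∀ {i j} → element i ≈ element j → i ≡ j
  element-injective {i} {j} = proj₁ (proj₂ card) i j

  index-injective : ∀ {x y} → index x ≡ index y → x ≈ y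
  index-injective {x} {y} eq = begin
    x                 ≈⟨ element-index x ⟨
    element (index x) ≡⟨ ≡-cong element eq ⟩
    element (index y) ≈⟨ element-index y ⟩
    y                 ∎

  _≈?_ : ∀ x y → Dec (x ≈ y)
  x ≈? y = map′ index-injective
    (λ x≈y → element-injective (trans (element-index x) (trans x≈y (sym (element-index y)))))
    (index x ≟ꟳ index y)

  1<q : 1 < q
  1<q = distinct⇒1<n (index 1#) (index 0#) (1≉0 ∘ index-injective)

  vector : ∀ {m} → Fin (q ^ m) → Vec m
  vector i = element ∘ finToFun i

  code : ∀ {m} → Vec m → Fin (q ^ m)
  code a = funToFin (index ∘ a)

  vector-code : ∀ {m} (a : Vec m) → vector (code a) ≋ a
  vector-code a i = trans (reflexive (≡-cong element (finToFun-funToFin (index ∘ a) i))) (element-index (a i))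

  code-injective : ∀ {m} {a b : Vec m} → code a ≡ code b → a ≋ b
  code-injective {m} {a} {b} eq i = begin
    a i                 ≈⟨ vector-code a i ⟨
    vector (code a) i   ≡⟨ ≡-cong (λ p → vector {m} p i) eq ⟩
    vector (code b) i   ≈⟨ vector-code b i ⟩
    b i                 ∎

  vector-injective : ∀ {m} {i j : Fin (q ^ m)} → vector {m} i ≋ vector j → i ≡ j
  vector-injective {m} {i} {j} eq =
    ≡-trans (≡-sym (funToFin-finToFin {m} i)) (≡-trans (funToFin-cong (λ l → element-injective (eq l))) (funToFin-finToFin {m} j))
    where
    funToFin-cong : ∀ {m} {f g : Fin m → Fin q} → (∀ i → f i ≡ g i) → funToFin f ≡ funToFin g
    funToFin-cong {zero}  f≗g = ≡-refl
    funToFin-cong {suc m} f≗g = ≡-cong₂ Data.Fin.combine (f≗g zero) (funToFin-cong (f≗g ∘ suc))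

  -- Pigeonhole from `q ^ k` arguments to `q ^ m` values. `T` may be any function, so a choice of
  -- coordinates can be used without proving it linear.
  collision : ∀ {m k} → m < k → (T : Vec k → Vec m) →
    ∃ λ φ → ∃ λ ψ → T φ ≋ T ψ × ∃ λ j → ¬ (φ j ≈ ψ j)
  collision {m} {k} m<k T with i , j , i<j , eq ← pigeonhole (^-monoʳ-< q 1<q m<k) (λ i → code (T (vector {k} i))) =
    vector i , vector j , code-injective eq ,
    ¬∀⟶∃¬ k _ (λ l → vector i l ≈? vector j l) (λ all≈ → <⇒≢ i<j (vector-injective all≈))

  dependent : ∀ {m k} → m < k → (A : Fin k → Vec m) →
    ∃ λ φ → lincomb φ A ≋ (λ _ → 0#) × ∃ λ j → ¬ (φ j ≈ 0#)
  dependent m<k A with φ , ψ , eq , j , φj≉ψj ← collision m<k (λ φ → lincomb φ A) =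
    axpy (- 1#) ψ φ , relation A φ ψ eq , j , λ χj≈0 → φj≉ψj (-1*x+y≈0⇒y≈x χj≈0)

  -- As `a < k`, two different combinations of `G` receive the same coordinates over `A`; their
  -- difference is a nontrivial relation of `G`.
  linIndep-≤ : ∀ {a k n} {A : Fin a → Vec n} {G : Fin k → Vec n} → a < k → (∀ i → Span A (G i)) → ¬ LinIndep G
  linIndep-≤ {A = A} {G} a<k G⊆A indep
    with φ , ψ , eq , j , φj≉ψj ← collision a<k (λ φ → proj₁ (lincomb-closed (span-isSubspace A) G⊆A φ)) =
    φj≉ψj (-1*x+y≈0⇒y≈x (indep _ (relation G φ ψ same) j))
    where
    coordinates : ∀ φ → Span A (lincomb φ G)
    coordinates = lincomb-closed (span-isSubspace A) G⊆A
    same : lincomb φ G ≋ lincomb ψ G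
    same l = begin
      lincomb φ G l                         ≈⟨ proj₂ (coordinates φ) l ⟩
      lincomb (proj₁ (coordinates φ)) A l   ≈⟨ lincomb-cong A eq l ⟩
      lincomb (proj₁ (coordinates ψ)) A l   ≈⟨ proj₂ (coordinates ψ) l ⟨
      lincomb ψ G l                         ∎

  -- Decidable spans and extension of independent families.

  opaque
    span? : ∀ {m n} (A : Fin m → Vec n) v → Dec (Span A v)
    span? {m} A v = map′
      (λ (i , eq) → vector i , eq)
      (λ (a , eq) → code a , λ j → trans (eq j) (sym (lincomb-cong A (vector-code a) j)))
      (any? (λ i → all? (λ j → v j ≈? lincomb (vector {m} i) A j)))

  linIndep-∷ : ∀ {m n} {A : Fin m → Vec n} {v} → LinIndep A → ¬ Span A v → LinIndep (v ◂ A)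
  linIndep-∷ {A = A} {v} indep v∉A a eq = λ where
      zero    → a₀≈0
      (suc i) → indep (a ∘ suc) (λ j → trans (sym (0*x+y≈y a₀≈0)) (eq j)) i
    where
    sub : IsSubspace (Span A)
    sub = span-isSubspace A
    a₀≈0 : a zero ≈ 0#
    -- A nonzero coefficient would let the relation be solved for `v`.
    a₀≈0 = decidable-stable (a zero ≈? 0#) λ a₀≉0 → let y , a₀y≈1 = inverse (a zero) a₀≉0 in
      v∉A (resp sub (λ j → sym (solve-vector (sym (eq j)) a₀y≈1))
        (axpy-closed sub y (zero-closed sub)
          (axpy-closed sub (- y) (a ∘ suc , λ _ → refl) (zero-closed sub))))

  -- A vector outside `Span A` would give `k + 1` independent vectors in the span of `k`.
  linIndep-spans : ∀ {k n} {A G : Fin k → Vec n} → LinIndep A → (∀ i → Span G (A i)) → ∀ {v} → Span G v → Span A v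
  linIndep-spans {A = A} indep A⊆G {v} v∈G = decidable-stable (span? A v) λ v∉A →
    linIndep-≤ {G = v ◂ A} (n<1+n _) (λ { zero → v∈G ; (suc i) → A⊆G i }) (linIndep-∷ indep v∉A)

  -- The independent rows of a square matrix span every unit vector. A column relation is a
  -- functional killing the rows, and its value at `unit p` is `b p`.
  rowGood⇒good : ∀ {t n} (A : Fin t → Vec n) → RowGood t A → Good t A
  rowGood⇒good A rowGood s inj b eq p =
    trans (sym (Σ-unit p b)) (trans (Σ-cong (λ l → *-comm (unit p l) (b l)))
      (span-least (kernel-isSubspace id b) eq unit∈rows))
    where
    rows : Fin _ → Vec _
    rows i l = A i (s l)
    unit∈rows : Span rows (unit p)
    unit∈rows = decidable-stable (span? rows (unit p)) λ unit∉ →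
      let φ , φ-rel , j , φj≉0 = dependent (n<1+n _) (unit p ◂ rows)
      in φj≉0 (linIndep-∷ (rowGood s inj) unit∉ φ φ-rel j)

  outside : ∀ {k a n} (G : Fin k → Vec n) (A : Fin a → Vec n) → LinIndep G → a < k → ∃ λ i → ¬ Span A (G i)
  outside {k} G A indepG a<k = ¬∀⟶∃¬ k _ (λ i → span? A (G i)) (λ G⊆A → linIndep-≤ a<k G⊆A indepG)

  opaque
    -- `d` counts the rows of `G` still to be added. Stopping at `b` below `k` is what yields the
    -- hyperplane in `insert`.
    extend-linIndep : ∀ {k n} (G : Fin k → Vec n) → LinIndep G → ∀ d {a b} → d +ℕ a ≡ b → b ≤ k →
      (A : Fin a → Vec n) → LinIndep A → (∀ i → Span G (A i)) →
      ∃ λ (B : Fin b → Vec n) → LinIndep B × (∀ i → Span G (B i)) × (∀ i → Span B (A i))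
    extend-linIndep G indepG zero ≡-refl b≤k A indepA A⊆G = A , indepA , A⊆G , span-row A
    extend-linIndep G indepG (suc d) {a} ≡-refl b≤k A indepA A⊆G =
      let i , Gi∉A = outside G A indepG (≤-trans (s≤s (m≤n+m a d)) b≤k)
          B , indepB , B⊆G , GiA⊆B = extend-linIndep G indepG d (+-suc d a) b≤k (G i ◂ A) (linIndep-∷ indepA Gi∉A)
            (λ { zero → span-row G i ; (suc j) → A⊆G j })
      in B , indepB , B⊆G , GiA⊆B ∘ suc

  -- Vectors outside the kernels of fewer than `q` functionals.

  avoid-values : (l : List Carrier) → length l < q → ∃ λ x → All (λ y → ¬ (x ≈ y)) l
  avoid-values l l<q = element (proj₁ missed) , ¬Any⇒All¬ l (proj₂ missed)
    where
    ¬all : ¬ (∀ i → Any (element i ≈_) l)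
    ¬all covered with i , j , i<j , eq ← pigeonhole l<q (λ i → Any.index (covered i)) =
      <⇒≢ i<j (element-injective (begin
        element i                                      ≈⟨ lookup-index (covered i) ⟩
        Data.List.lookup l (Any.index (covered i))     ≡⟨ ≡-cong (Data.List.lookup l) eq ⟩
        Data.List.lookup l (Any.index (covered j))     ≈⟨ lookup-index (covered j) ⟨
        element j                                      ∎))
    missed : ∃ λ i → ¬ Any (element i ≈_) l
    missed = ¬∀⟶∃¬ q _ (λ i → Any.any? (element i ≈?_) l) ¬all

  -- The zero of x ↦ x u + v, and a junk value if u is zero.
  root : Carrier → Carrier → Carrier
  root u v with u ≈? 0#
  ... | yes _  = 0#
  ... | no u≉0 = - v * proj₁ (inverse u u≉0)

  root-unique : ∀ {x} u v → ¬ (u ≈ 0# × v ≈ 0#) → ¬ (x ≈ root u v) → ¬ (x * u + v ≈ 0#)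
  root-unique {x} u v uv≉0 x≉root eq with u ≈? 0#
  ... | no u≉0  = x≉root (solve-coefficient eq (proj₂ (inverse u u≉0)))
  ... | yes u≈0 = uv≉0 (u≈0 , trans (sym (trans (+-congʳ (trans (*-congˡ u≈0) (zeroʳ x))) (+-identityˡ v))) eq)

  -- Let `m` avoid the kernels of the tail and `d` the first kernel. No functional of the list
  -- vanishes on the whole line `x m + d`, so each excludes at most one `x`, fewer than `q` in all.
  avoid-kernels : ∀ {i n p} {I : Set i} {P : Vec n → Set p} → IsSubspace P →
    (f : I → Vec n → Carrier) → (∀ i x u v → f i (axpy x u v) ≈ x * f i u + f i v) →
    (l : List I) → length l < q → All (λ i → ∃ λ y → P y × ¬ (f i y ≈ 0#)) l →
    ∃ λ m → P m × All (λ i → ¬ (f i m ≈ 0#)) l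
  avoid-kernels sub f linear []      l<q []                   = (λ _ → 0#) , zero-closed sub , []
  avoid-kernels sub f linear (i ∷ l) l<q ((d , Pd , fid≉0) ∷ ys)
    with m , Pm , fm≉0 ← avoid-kernels sub f linear l (<⇒≤ l<q) ys
    with x , x≉roots ← avoid-values (map (λ j → root (f j m) (f j d)) (i ∷ l))
                         (≤-trans (s≤s (≤-reflexive (length-map _ (i ∷ l)))) l<q) =
    axpy x m d , axpy-closed sub x Pm Pd ,
    All.zipWith (λ {j} (nonzero , x≉root) eq → root-unique (f j m) (f j d) nonzero x≉root (trans (sym (linear j x m d)) eq))
      (((fid≉0 ∘ proj₂) ∷ All.map (_∘ proj₁) fm≉0) , map⁻ x≉roots)

  -- Extending row-independent families by vectors of a good code.

  opaque
    extend-rowGood : ∀ {t j k n} → n C t < q → j < t → (B : Fin j → Vec n) → RowGood t B →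
      (G : Fin k → Vec n) → Good t G → ∃ λ m → Span G m × RowGood t (m ◂ B)
    extend-rowGood {t} {j} {k} {n} nCt<q j<t B rowGood G good =
      let m , m∈G , fm≉0 = avoid-kernels (span-isSubspace G) f (λ s → functional-axpy s (b s)) (subsets n t)
            (≤-trans (s≤s (≤-reflexive (length-subsets n t))) nCt<q) (All.map nonvanishing (subsets-injective n t))
      in m , m∈G , rowGood-∷ B m rowGood (All.map (λ {s} fsm≉0 → b s , proj₁ (proj₂ (annihilator s)) , fsm≉0) fm≉0)
      where
      annihilator : (s : Fin t → Fin n) → ∃ λ b → (∀ i → functional s b (B i) ≈ 0#) × ∃ λ l → ¬ (b l ≈ 0#)
      -- The `t` columns of `B` chosen by `s` lie in dimension `j < t`, so they satisfy a nontrivial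
      -- relation.
      annihilator s = dependent j<t (λ l i → B i (s l))
      b : (Fin t → Fin n) → Vec t
      b s = proj₁ (annihilator s)
      f : (Fin t → Fin n) → Vec n → Carrier
      f s = functional s (b s)
      nonvanishing : ∀ {s} → Injective _≡_ _≡_ s → ∃ λ y → Span G y × ¬ (f s y ≈ 0#)
      nonvanishing {s} inj =
        let l , bl≉0  = proj₂ (proj₂ (annihilator s))
            -- Vanishing on all rows of `G` would be a relation among its columns `s`, contradicting
            -- `bl≉0`.
            i , fGi≉0 = ¬∀⟶∃¬ k _ (λ i → f s (G i) ≈? 0#) (λ all≈0 → bl≉0 (good s inj (b s) all≈0 l))
        in G i , span-row G i , fGi≉0

  rowGood-subfamily : ∀ {t k n} → n C t < q → (G : Fin k → Vec n) → Good t G → ∀ j → j ≤ t →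
    ∃ λ (B : Fin j → Vec n) → RowGood t B × (∀ i → Span G (B i))
  rowGood-subfamily nCt<q G good zero    j≤t = (λ ()) , (λ _ _ _ _ ()) , λ ()
  rowGood-subfamily nCt<q G good (suc j) j<t =
    let B , rowGood , B⊆G = rowGood-subfamily nCt<q G good j (<⇒≤ j<t)
        m , m∈G , rowGood′ = extend-rowGood nCt<q j<t B rowGood G good
    in m ◂ B , rowGood′ , λ { zero → m∈G ; (suc i) → B⊆G i }

  -- Moving along edges while keeping a chosen family.

  _⊆_ : ∀ {a t n k} → (Fin a → Vec n) → Vertex t n k → Set (c ⊔ ℓ)
  A ⊆ (X , _) = ∀ i → X (A i)

  ∈⇒span : ∀ {t n k} ((X , G , _) : Vertex t n k) → ∀ {v} → X v → Span G v
  ∈⇒span (X , G , (_ , gen) , _) = proj₁ (gen _)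

  span⇒∈ : ∀ {t n k} ((X , G , _) : Vertex t n k) → ∀ {v} → Span G v → X v
  span⇒∈ (X , G , (_ , gen) , _) = proj₂ (gen _)

  span-code : ∀ {t n k} (G : Fin k → Vec n) → LinIndep G → Good t G → Vertex t n k
  span-code G indep good = Span G , G , (indep , λ v → id , id) , good

  opaque
    -- At most `k` vectors leave room for a hyperplane of `X` containing `A`. Returning a map of
    -- walks covers both cases: the identity if `v` is already in `X`, one edge otherwise.
    insert : ∀ {a t n k} → a ≤ k → (A : Fin a → Vec n) → LinIndep A → Good t A →
      (X : Vertex t n (suc k)) → A ⊆ X → ∀ v →
      ∃ λ X′ → A ⊆ X′ × proj₁ X′ v × (∀ {Y} → Walk t n (suc k) X′ Y → Walk t n (suc k) X Y)
    insert {a} {t} {n} {k} a≤k A indepA goodA X@(_ , G , (indepG , gen) , _) A⊆X v with span? G v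
    ... | yes v∈G = X , A⊆X , span⇒∈ X v∈G , id
    ... | no v∉G
      with B , indepB , B⊆G , A⊆B ← extend-linIndep G indepG (k ∸ℕ a) (m∸n+n≡m a≤k) (<⇒≤ (n<1+n k)) A indepA (∈⇒span X ∘ A⊆X) =
      X′ , (λ i → span-tail (v ◂ B) (A⊆B i)) , span-row (v ◂ B) zero , step adjacent
      where
      subG : IsSubspace (Span G)
      subG = span-isSubspace G
      subB : IsSubspace (Span B)
      subB = span-isSubspace B
      goodB : Good t B
      goodB = good-mono A B A⊆B goodA
      X′ : Vertex t n (suc k)
      X′ = span-code (v ◂ B) (linIndep-∷ indepB (v∉G ∘ span-least subG B⊆G)) (good-mono A (v ◂ B) (span-tail (v ◂ B) ∘ A⊆B) goodA)
      meet⊆B : ∀ w → Span G w → Span (v ◂ B) w → Span B w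
      meet⊆B w w∈G (b , eq) = resp subB (λ j → sym (trans (eq j) (0*x+y≈y b₀≈0))) (b ∘ suc , λ _ → refl)
        where
        b₀≈0 : b zero ≈ 0#
        -- A vector of `X` with a nonzero coefficient at `v` would put `v` into `X`.
        b₀≈0 = decidable-stable (b zero ≈? 0#) λ b₀≉0 → let y , b₀y≈1 = inverse (b zero) b₀≉0 in
          v∉G (resp subG (λ j → sym (solve-vector (eq j) b₀y≈1))
            (axpy-closed subG y w∈G (axpy-closed subG (- y) (lincomb-closed subG B⊆G (b ∘ suc)) (zero-closed subG))))
      adjacent : Adjacent t n (suc k) X X′
      adjacent = B , (indepB , λ w →
        (λ (w∈X , w∈X′) → meet⊆B w (∈⇒span X w∈X) w∈X′) ,
        (λ w∈B → span⇒∈ X (span-least subG B⊆G w∈B) , span-tail (v ◂ B) w∈B)) , goodB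

  -- `d` is the number of vectors that `A` lacks to be a basis of both codes. Each round brings a
  -- row of `Y` outside `Span A` into `X`; at zero the two codes coincide.
  walk-common : ∀ {t n k} d {a} → d +ℕ a ≡ suc k → (A : Fin a → Vec n) → LinIndep A → Good t A →
    (X Y : Vertex t n (suc k)) → A ⊆ X → A ⊆ Y → Walk t n (suc k) X Y
  walk-common zero ≡-refl A indepA goodA X Y A⊆X A⊆Y = here λ v → through X Y A⊆X A⊆Y , through Y X A⊆Y A⊆X
    where
    through : ∀ X Y → A ⊆ X → A ⊆ Y → ∀ {v} → proj₁ X v → proj₁ Y v
    through X@(_ , G , _) Y@(_ , H , _) A⊆X A⊆Y v∈X = span⇒∈ Y (span-least (span-isSubspace H) (∈⇒span Y ∘ A⊆Y)
      (linIndep-spans {G = G} indepA (∈⇒span X ∘ A⊆X) (∈⇒span X v∈X)))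
  walk-common {k = k} (suc d) {a} ≡-refl A indepA goodA X Y@(_ , H , (indepH , _) , _) A⊆X A⊆Y =
    let i , Hi∉A = outside H A indepH (s≤s (m≤n+m a d))
        X′ , A⊆X′ , Hi∈X′ , walk = insert (m≤n+m a d) A indepA goodA X A⊆X (H i)
    in walk (walk-common d (+-suc d a) (H i ◂ A) (linIndep-∷ indepA Hi∉A)
         (good-mono A (H i ◂ A) (span-tail (H i ◂ A) ∘ span-row A) goodA) X′ Y
         (λ { zero → Hi∈X′ ; (suc j) → A⊆X′ j })
         (λ { zero → span⇒∈ Y (span-row H i) ; (suc j) → A⊆Y j }))

  -- The first `j` vectors of `A` lie in `Y`, and `d` remain to be replaced. `insert` adds `m` while
  -- keeping all of `A`; only then is the last vector forgotten.
  walk-replacing : ∀ {t n k} → n C t < q → t ≤ k → t ≤ n → ∀ d {j} → d +ℕ j ≡ t →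
    (A : Fin t → Vec n) → RowGood t A → (X Y : Vertex t n (suc k)) → A ⊆ X →
    (∀ i → toℕ i < j → proj₁ Y (A i)) → Walk t n (suc k) X Y
  walk-replacing {t} {k = k} nCt<q t≤k t≤n zero ≡-refl A rowGood X Y A⊆X A⊆Y =
    walk-common (suc k ∸ℕ t) (m∸n+n≡m (≤-trans t≤k (<⇒≤ (n<1+n k)))) A
      (rowGood⇒linIndep A t≤n rowGood) (rowGood⇒good A rowGood) X Y A⊆X (λ i → A⊆Y i (toℕ<n i))
  walk-replacing {suc t} nCt<q t≤k t≤n (suc d) {j} d+j≡t A rowGood X Y@(_ , H , _ , goodH) A⊆X A⊆Y =
    let m , m∈H , rowGood′ = extend-rowGood nCt<q (n<1+n t) (A ∘ inject₁)
          (λ s inj → linIndep-init (λ i l → A i (s l)) (rowGood s inj)) H goodH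
        X′ , A⊆X′ , m∈X′ , walk = insert t≤k A (rowGood⇒linIndep A t≤n rowGood) (rowGood⇒good A rowGood) X A⊆X m
    -- Entering `m` at the front shifts the vectors already in `Y`; since `j` is at most the last
    -- index, the dropped vector is not among them.
    in walk (walk-replacing nCt<q t≤k t≤n d (≡-trans (+-suc d j) d+j≡t) (m ◂ (A ∘ inject₁)) rowGood′ X′ Y
         (λ { zero → m∈X′ ; (suc i) → A⊆X′ (inject₁ i) })
         (λ { zero _ → span⇒∈ Y m∈H
            ; (suc i) i<j → A⊆Y (inject₁ i) (≡-subst (_< j) (≡-sym (toℕ-inject₁ i)) (s≤s⁻¹ i<j)) }))

  connected : ∀ {t n k} → n C t < q → t ≤ k → t ≤ n → Connected t n (suc k)
  connected {t} nCt<q t≤k t≤n X@(_ , G , _ , goodG) Y =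
    let A , rowGood , A⊆G = rowGood-subfamily nCt<q G goodG t ≤-refl
    in walk-replacing nCt<q t≤k t≤n t (+ℕ-identityʳ t) A rowGood X Y (span⇒∈ X ∘ A⊆G) (λ _ ())

  -- The intersection would have a generator matrix with `k` rows and `k + 1` independent columns.
  noEdges : ∀ {n k} → suc k ≤ n → NoEdges (suc k) n (suc k)
  noEdges k<n X Y (G , _ , good) =
    let φ , φ-rel , j , φj≉0 = dependent (n<1+n _) (λ j i → G i (inject≤ j k<n))
    in φj≉0 (good (λ j → inject≤ j k<n) (λ {i} {j} → inject≤-injective k<n k<n i j) φ φ-rel j)

theorem1p9 : ∀ {c ℓ : Level} (q : ℕ) (F : Field c ℓ) → IsPrimePower q → HasCardinality F q →
    (n k t : ℕ) → 0 < k → k < n → t ≤ k →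
    ((q > n C t) → t < k → LinearAlgebra.Connected F t n k) ×
    (t ≡ k → LinearAlgebra.NoEdges F t n k)
theorem1p9 q F _ card n (suc k) t _ k<n t≤k =
  -- The dimension is `suc k`, so the strict inequality says that `t` vectors fit into a hyperplane.
  (λ nCt<q t<k → connected nCt<q (s≤s⁻¹ t<k) (≤-trans t≤k (<⇒≤ k<n))) ,
  λ { ≡-refl → noEdges (<⇒≤ k<n) }
  where open Finite q F card
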